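{- Let $n>2$ and $t>2$ be two positive integers. Then \[\varphi(S_n\boxdot S_t)=\begin{cases} 2n+1, & \text{if } n\leq \frac {t+1}2,\\ t+2, & \text{if } \frac {t+1}2<n<t,\\ \min\{n,t+3\}+2, & \text{otherwise}. \end{cases}\]
   Context: All graphs are finite and simple. $S_n$ denotes the star with $n$ leaves (so it has $n+1$ vertices). The subdivision graph $S(G)$ of a graph $G$ is obtained by inserting one new vertex into every edge of $G$. For graphs $G$ and $H$, with $V(G)=\{u_0,\ldots,u_{m-1}\}$, the subdivision-vertex neighbourhood corona (SVN corona) $G\boxdot H$ is the graph obtained from $S(G)$ by adding $m$ vertex-disjoint copies of $H$ (one for each $u_i$) and joining, for each $i$, every vertex of $N_{S(G)}(u_i)$ (the neighbourhood of $u_i$ in $S(G)$) to every vertex of the copy of $H$ associated with $u_i$. A $b$-chromatic coloring of a graph with $k$ colors is a proper coloring with colors $0,\ldots,k-1$ such that, for each color $i$, there is a vertex (a $b$-vertex) of color $i$ having, for each color $j\neq i$, a neighbour of color $j$. The $b$-chromatic number $\varphi(G)$ is the maximum $k$ for which $G$ has a $b$-chromatic coloring with $k$ colors. -}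

module Defs where

open import Data.Bool.Base using (Bool; true; false; T; _∧_; _∨_)
open import Data.Fin.Base using (Fin; zero; suc)
open import Data.Fin.Properties using (+↔⊎; *↔×; 0↔⊥; 1↔⊤)
import Data.Fin.Properties as Fin
open import Data.Nat.Base using (ℕ; zero; suc; _+_; _*_; _≤_)
open import Data.Product.Base using (Σ; ∃; _×_; _,_; proj₁; proj₂)
open import Data.Product.Function.Dependent.Propositional using (Σ-↔)
open import Data.Product.Function.NonDependent.Propositional using (_×-↔_)
open import Data.Sum.Base using (_⊎_; inj₁; inj₂)
open import Data.Sum.Function.Propositional using (_⊎-↔_)
open import Function.Base using (_∘_)
open import Function.Bundles using (_↔_; mk↔ₛ′; module Inverse)
open import Function.Construct.Composition using (_↔-∘_)
open import Function.Construct.Identity using (↔-id)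
open import Function.Construct.Symmetry using (↔-sym)
open import Function.Properties.Inverse using (↔⇒↣)
open import Relation.Binary.Definitions using (DecidableEquality)
open import Relation.Binary.PropositionalEquality.Core
  using (_≡_; _≢_; refl; sym; cong₂)
open import Relation.Nullary.Decidable.Core using (yes; no; ⌊_⌋)
open import Relation.Nullary.Decidable using (via-injection)
open import Relation.Nullary.Negation.Core using (contradiction)

Finite : Set → Set
Finite A = ∃ λ n → A ↔ Fin n

Fin-finite : ∀ n → Finite (Fin n)
Fin-finite n = n , ↔-id _

⊎-finite : ∀ {A B} → Finite A → Finite B → Finite (A ⊎ B)
⊎-finite (m , f) (n , g) = m + n , (↔-sym +↔⊎ ↔-∘ (f ⊎-↔ g))

×-finite : ∀ {A B} → Finite A → Finite B → Finite (A × B)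
×-finite (m , f) (n , g) = m * n , (↔-sym *↔× ↔-∘ (f ×-↔ g))

T-finite : ∀ b → Finite (T b)
T-finite false = 0 , ↔-sym 0↔⊥
T-finite true  = 1 , ↔-sym 1↔⊤

filterFin-finite : ∀ n (p : Fin n → Bool) → Finite (Σ (Fin n) (T ∘ p))
filterFin-finite zero    p = 0 , mk↔ₛ′ proj₁ (λ ()) (λ ()) (λ { (() , _) })
filterFin-finite (suc n) p =
  let k , f = ⊎-finite (T-finite (p zero)) (filterFin-finite n (p ∘ suc))
  in  k , (f ↔-∘ mk↔ₛ′ to from
             (λ { (inj₁ _) → refl ; (inj₂ _) → refl })
             (λ { (zero , _) → refl ; (suc _ , _) → refl }))
  where
  to : Σ (Fin (suc n)) (T ∘ p) → T (p zero) ⊎ Σ (Fin n) (T ∘ p ∘ suc)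
  to (zero  , h) = inj₁ h
  to (suc i , h) = inj₂ (i , h)
  from : T (p zero) ⊎ Σ (Fin n) (T ∘ p ∘ suc) → Σ (Fin (suc n)) (T ∘ p)
  from (inj₁ h)       = zero , h
  from (inj₂ (i , h)) = suc i , h

filter-finite : ∀ {A} → Finite A → (p : A → Bool) → Finite (Σ A (T ∘ p))
filter-finite (n , f) p =
  let k , g = filterFin-finite n (p ∘ Inverse.from f)
  in  k , (g ↔-∘ ↔-sym (Σ-↔ (↔-sym f) (↔-id _)))

record Graph : Set₁ where
  field
    Vertex     : Set
    finite     : Finite Vertex
    adj        : Vertex → Vertex → Bool
    adj-sym    : ∀ u v → adj u v ≡ adj v u
    adj-irrefl : ∀ v → adj v v ≡ false

  Adj : Vertex → Vertex → Set
  Adj u v = T (adj u v)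

  index : Vertex → Fin (proj₁ finite)
  index = Inverse.to (proj₂ finite)

  _≟_ : DecidableEquality Vertex
  _≟_ = via-injection (↔⇒↣ (proj₂ finite)) Fin._≟_

  -- An undirected edge is represented once, by its endpoints in increasing
  -- index order.  Membership in T is proof-irrelevant, so distinct elements of
  -- Edge have distinct endpoint pairs.
  isEdge : Vertex × Vertex → Bool
  isEdge (u , v) = ⌊ index u Fin.<? index v ⌋ ∧ adj u v

  Edge : Set
  Edge = Σ (Vertex × Vertex) (T ∘ isEdge)

  isEndpoint : Vertex → Edge → Bool
  isEndpoint w ((u , v) , _) = ⌊ w ≟ u ⌋ ∨ ⌊ w ≟ v ⌋

-- zero is the centre, suc i are the n leaves.
Star : ℕ → Graph
Star n = record
  { Vertex     = Fin (suc n)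
  ; finite     = Fin-finite (suc n)
  ; adj        = adj
  ; adj-sym    = λ { zero zero → refl ; zero (suc _) → refl
                   ; (suc _) zero → refl ; (suc _) (suc _) → refl }
  ; adj-irrefl = λ { zero → refl ; (suc _) → refl }
  }
  where
  adj : Fin (suc n) → Fin (suc n) → Bool
  adj zero    zero    = false
  adj zero    (suc _) = true
  adj (suc _) zero    = true
  adj (suc _) (suc _) = false

Subdivision : Graph → Graph
Subdivision G = record
  { Vertex     = Vertex ⊎ Edge
  ; finite     = ⊎-finite finite (filter-finite (×-finite finite finite) isEdge)
  ; adj        = adjS
  ; adj-sym    = λ { (inj₁ _) (inj₁ _) → refl ; (inj₁ _) (inj₂ _) → refl
                   ; (inj₂ _) (inj₁ _) → refl ; (inj₂ _) (inj₂ _) → refl }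
  ; adj-irrefl = λ { (inj₁ _) → refl ; (inj₂ _) → refl }
  }
  where
  open Graph G
  adjS : Vertex ⊎ Edge → Vertex ⊎ Edge → Bool
  adjS (inj₁ _) (inj₁ _) = false
  adjS (inj₁ w) (inj₂ e) = isEndpoint w e
  adjS (inj₂ e) (inj₁ w) = isEndpoint w e
  adjS (inj₂ _) (inj₂ _) = false

infixl 6 _⊡_

-- Subdivision-vertex neighbourhood corona; inj₂ (u , h) is the vertex h of the
-- copy of H associated with u.
_⊡_ : Graph → Graph → Graph
G ⊡ H = record
  { Vertex     = S.Vertex ⊎ (G.Vertex × H.Vertex)
  ; finite     = ⊎-finite S.finite (×-finite G.finite H.finite)
  ; adj        = adj
  ; adj-sym    = λ { (inj₁ x) (inj₁ y) → S.adj-sym x y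
                   ; (inj₁ _) (inj₂ _) → refl
                   ; (inj₂ _) (inj₁ _) → refl
                   ; (inj₂ (u , h)) (inj₂ (v , k)) →
                       cong₂ _∧_ (≟-sym u v) (H.adj-sym h k) }
  ; adj-irrefl = λ { (inj₁ x) → S.adj-irrefl x
                   ; (inj₂ (u , h)) → ∧-false ⌊ u G.≟ u ⌋ (H.adj-irrefl h) }
  }
  where
  module G = Graph G
  module H = Graph H
  module S = Graph (Subdivision G)

  adj : S.Vertex ⊎ (G.Vertex × H.Vertex) → S.Vertex ⊎ (G.Vertex × H.Vertex) → Bool
  adj (inj₁ x)       (inj₁ y)       = S.adj x y
  adj (inj₁ x)       (inj₂ (u , _)) = S.adj (inj₁ u) x
  adj (inj₂ (u , _)) (inj₁ x)       = S.adj (inj₁ u) x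
  adj (inj₂ (u , h)) (inj₂ (v , k)) = ⌊ u G.≟ v ⌋ ∧ H.adj h k

  ≟-sym : ∀ u v → ⌊ u G.≟ v ⌋ ≡ ⌊ v G.≟ u ⌋
  ≟-sym u v with u G.≟ v | v G.≟ u
  ... | yes _ | yes _ = refl
  ... | no  _ | no  _ = refl
  ... | yes p | no ¬q = contradiction (sym p) ¬q
  ... | no ¬p | yes q = contradiction (sym q) ¬p

  ∧-false : ∀ a {b} → b ≡ false → a ∧ b ≡ false
  ∧-false false _ = refl
  ∧-false true  p = p

module _ (G : Graph) where
  open Graph G

  IsProper : ∀ {k} → (Vertex → Fin k) → Set
  IsProper c = ∀ u v → Adj u v → c u ≢ c v

  IsBVertex : ∀ {k} → (Vertex → Fin k) → Fin k → Vertex → Set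
  IsBVertex c i v =
    c v ≡ i × (∀ j → j ≢ i → ∃ λ w → Adj v w × c w ≡ j)

  IsBChromaticColoring : ∀ {k} → (Vertex → Fin k) → Set
  IsBChromaticColoring c = IsProper c × (∀ i → ∃ λ v → IsBVertex c i v)

  HasBChromaticColoring : ℕ → Set
  HasBChromaticColoring k = ∃ λ (c : Vertex → Fin k) → IsBChromaticColoring c

  -- φ(G) = k.
  IsBChromaticNumber : ℕ → Set
  IsBChromaticNumber k =
    HasBChromaticColoring k × (∀ l → HasBChromaticColoring l → l ≤ k)

{-# OPTIONS --safe #-}
-- Write x for the centre of Sₙ, eᵢ for the subdivision vertices and H₀, Hᵢ for
-- the copies of Sₜ attached to the centre and to the leaves.
--
-- Upper bounds.  Besides the eᵢ and the centres of the n + 1 copies, every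
-- vertex has degree at most n + 1, so at most 2n + 1 colours are possible.  With
-- more than t + 2 colours the centres of the Hᵢ drop out too, and b-vertices lie
-- among the eᵢ, x and H₀.  A b-vertex x or a leaf of H₀ sees only the colours of
-- the eᵢ and one more, so if A is the set of colours of the eᵢ, at most |A| + 2
-- colours occur.  Finally |A| ≤ n, and |A| ≤ t + 3 because some eᵢ is a b-vertex
-- which must see A \ {c(eᵢ)} on Hᵢ and on one leaf of Sₙ, as x and H₀ avoid A.
--
-- Lower bounds.  Either the eᵢ get n distinct colours, and the remaining ones
-- have the centres of H₀ and some Hᵢ as b-vertices; or the eᵢ exhaust all but two
-- colours, which have the centre and the leaves of H₀ as b-vertices.
module Submission where

open import Defs
open import Data.Bool.Base using (if_then_else_; _∧_; T)
open import Data.Bool.Properties using (T-∧)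
open import Data.Fin.Base
  using (Fin; zero; suc; punchIn; punchOut; lift; fromℕ<; splitAt; join; _↑ˡ_; _↑ʳ_)
open import Data.Fin.Properties
  using (_≟_; injective⇒≤; punchInᵢ≢i; punchIn-punchOut; punchIn-injective;
         suc-injective; splitAt-join; splitAt-↑ˡ; splitAt-↑ʳ; join-splitAt)
open import Data.Nat using (ℕ; suc; _+_; _*_; _∸_; _⊓_; _≤_; _<_; _>_; _≤?_; _<?_; z≤n; s≤s; s≤s⁻¹)
open import Data.Nat.Properties
  using (≤-refl; ≤-trans; ≤-reflexive; <⇒≤; <⇒≱; ≰⇒>; ≮⇒≥; n≤1+n; m≤m+n; m≤n+m;
         +-comm; +-identityʳ; +-suc; +-mono-≤; +-monoʳ-≤; m+[n∸m]≡n;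
         m<n⇒0<n; m<n⇒0<n∸m; m≤n+o⇒m∸n≤o; m⊓n≤m; m⊓n≤n; ⊓-glb)
open import Data.Product.Base using (∃; _×_; _,_; proj₁; proj₂; map)
open import Data.Sum.Base using (_⊎_; inj₁; inj₂; [_,_]′)
open import Data.Unit.Base using (tt)
open import Function.Base using (_∘_; const; id)
open import Function.Bundles using (module Equivalence)
open import Function.Definitions using (StrictlySurjective)
open import Relation.Binary.Core using (Rel)
open import Relation.Binary.PropositionalEquality
  using (_≡_; _≢_; refl; sym; trans; cong; subst; subst₂; ≢-sym)
open import Relation.Nullary.Decidable
  using (⌊_⌋; yes; no; toWitness; fromWitness; decidable-stable)
open import Relation.Nullary.Negation using (contradiction)

-- Counting colours by surjections of finite sets.

strictlySurjective⇒≤ : ∀ {m k} {g : Fin m → Fin k} → StrictlySurjective _≡_ g → k ≤ m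
strictlySurjective⇒≤ {g = g} surj = injective⇒≤ {f = proj₁ ∘ surj} λ {i} {j} eq →
  trans (sym (proj₂ (surj i))) (trans (cong g eq) (proj₂ (surj j)))

-- The bound is decidable, so its failure may be assumed; that rules out the second alternative for
-- every `j` and makes `g` surjective.
covering⇒≤ : ∀ {m k N} (g : Fin m → Fin k) → m ≤ N →
             (∀ j → (∃ λ p → g p ≡ j) ⊎ k ≤ N) → k ≤ N
covering⇒≤ {k = k} {N} g m≤N cov = decidable-stable (k ≤? N) λ k≰N →
  k≰N (≤-trans
    (strictlySurjective⇒≤ λ j → [ id , (λ k≤N → contradiction k≤N k≰N) ]′ (cov j)) m≤N)

surjection : ∀ {m n} → 0 < m → m ≤ n → ∃ λ (f : Fin n → Fin m) → StrictlySurjective _≡_ f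
surjection {1}           _ (s≤s _)   = const zero , λ { zero → zero , refl }
surjection {suc (suc _)} _ (s≤s m≤n) =
  let f , surj = surjection (s≤s z≤n) m≤n in
  lift 1 f , λ { zero → zero , refl ; (suc j) → map suc (cong suc) (surj j) }

-- In the colourings, `p` belongs to an edge vertex, `q` to the centre of the adjacent outer copy,
-- and the `s` positions must show all other colours.
record SurjectionAvoiding {m} (s : ℕ) (p q : Fin m) : Set where
  field
    at      : Fin s → Fin m
    avoids₁ : ∀ i → at i ≢ p
    avoids₂ : ∀ i → at i ≢ q
    hits    : ∀ j → j ≢ p → j ≢ q → ∃ λ i → at i ≡ j

-- Deleting `p` and then `q` leaves `m - 2` values: at least one by `3 ≤ m`, and few enough for `s`
-- positions to cover.
surjection-avoiding : ∀ {s m} → 3 ≤ m → m ≤ 2 + s → (p q : Fin m) → p ≢ q →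
                      SurjectionAvoiding s p q
surjection-avoiding {s} {suc (suc m)} (s≤s (s≤s 0<m)) (s≤s (s≤s m≤s)) p q p≢q =
  record { at = f ; avoids₁ = λ i → punchInᵢ≢i p _ ; avoids₂ = avoids-q ; hits = hits }
  where
  g : Fin s → Fin m
  g = proj₁ (surjection 0<m m≤s)

  q′ : Fin (suc m)
  q′ = punchOut p≢q

  f : Fin s → Fin (suc (suc m))
  f i = punchIn p (punchIn q′ (g i))

  avoids-q : ∀ i → f i ≢ q
  avoids-q i eq = punchInᵢ≢i q′ (g i)
    (punchIn-injective p _ _ (trans eq (sym (punchIn-punchOut p≢q))))

  hits : ∀ j → j ≢ p → j ≢ q → ∃ λ i → f i ≡ j
  hits j j≢p j≢q =
    let i , gi≡ = proj₂ (surjection 0<m m≤s) (punchOut q′≢) in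
    i , trans (cong (punchIn p) (trans (cong (punchIn q′) gi≡) (punchIn-punchOut q′≢)))
              (punchIn-punchOut p≢j)
    where
    p≢j : p ≢ j
    p≢j = ≢-sym j≢p
    q′≢ : q′ ≢ punchOut p≢j
    q′≢ eq = j≢q (trans (sym (punchIn-punchOut p≢j))
                   (trans (cong (punchIn p) (sym eq)) (punchIn-punchOut p≢q)))

-- An explicit model of the corona and transfer of b-colourings.

IsBVertexIn : ∀ {V : Set} {k} → Rel V _ → (V → Fin k) → Fin k → V → Set
IsBVertexIn R c i v = c v ≡ i × (∀ j → j ≢ i → ∃ λ w → R v w × c w ≡ j)

IsBColouring : ∀ {V : Set} {k} → Rel V _ → (V → Fin k) → Set
IsBColouring R c =
  (∀ u v → R u v → c u ≢ c v) × (∀ i → ∃ λ v → IsBVertexIn R c i v)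

-- Properness is pulled back along `to`; b-vertices and the neighbours they see are carried back by
-- `from`, so a one-sided inverse suffices.
IsBColouring-∘ : ∀ {V W : Set} {R : Rel V _} {S : Rel W _} {k}
  (to : V → W) (from : W → V) → (∀ w → to (from w) ≡ w) →
  (∀ {u v} → R u v → S (to u) (to v)) → (∀ {u v} → S u v → R (from u) (from v)) →
  {c : W → Fin k} → IsBColouring S c → IsBColouring R (c ∘ to)
IsBColouring-∘ to from to∘from to-mono from-mono {c} (proper , bvertex) =
  (λ u v uv → proper (to u) (to v) (to-mono uv)) ,
  λ i → let w , cw≡i , sees = bvertex i in
    from w , trans (cong c (to∘from w)) cw≡i , λ j j≢i →
      let w′ , ww′ , cw′≡j = sees j j≢i in
      from w′ , from-mono ww′ , trans (cong c (to∘from w′)) cw′≡j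

data CoronaVertex (n t : ℕ) : Set where
  orig : Fin (suc n) → CoronaVertex n t
  edge : Fin n → CoronaVertex n t
  copy : Fin (suc n) → Fin (suc t) → CoronaVertex n t

data Incident {n} : Fin (suc n) → Fin n → Set where
  hub  : ∀ {i} → Incident zero i
  leaf : ∀ {i} → Incident (suc i) i

infix 4 _~_

data _~_ {n t} : CoronaVertex n t → CoronaVertex n t → Set where
  orig-edge : ∀ {u i} → Incident u i → orig u ~ edge i
  edge-orig : ∀ {u i} → Incident u i → edge i ~ orig u
  copy-edge : ∀ {u a i} → Incident u i → copy u a ~ edge i
  edge-copy : ∀ {u a i} → Incident u i → edge i ~ copy u a
  copy-copy : ∀ {u a b} → Graph.Adj (Star t) a b → copy u a ~ copy u b

module Transfer (n t : ℕ) where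
  open Graph using (Vertex; Adj; Edge; isEndpoint)

  G : Graph
  G = Star n ⊡ Star t

  spoke : Fin n → Edge (Star n)
  spoke i = (zero , suc i) , tt

  -- Endpoints are listed by increasing index, so the centre comes first; two leaves fail the
  -- adjacency test.
  edge-spoke : (ε : Edge (Star n)) → ∃ λ i → spoke i ≡ ε
  edge-spoke ((zero , suc i) , _)     = i , refl
  edge-spoke ((suc _ , suc _) , prf) = contradiction (proj₂ (Equivalence.to T-∧ prf)) id

  incident⇒endpoint : ∀ {u i} → Incident u i → T (isEndpoint (Star n) u (spoke i))
  incident⇒endpoint hub      = tt
  incident⇒endpoint {i = i} leaf = fromWitness {a? = Graph._≟_ (Star n) (suc i) (suc i)} refl

  endpoint⇒incident : ∀ u i → T (isEndpoint (Star n) u (spoke i)) → Incident u i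
  endpoint⇒incident zero    i _ = hub
  endpoint⇒incident (suc j) i p
    with refl ← toWitness {a? = Graph._≟_ (Star n) (suc j) (suc i)} p = leaf

  to : Vertex G → CoronaVertex n t
  to (inj₁ (inj₁ u)) = orig u
  to (inj₁ (inj₂ ε)) = edge (proj₁ (edge-spoke ε))
  to (inj₂ (u , a))  = copy u a

  from : CoronaVertex n t → Vertex G
  from (orig u)   = inj₁ (inj₁ u)
  from (edge i)   = inj₁ (inj₂ (spoke i))
  from (copy u a) = inj₂ (u , a)

  to∘from : ∀ v → to (from v) ≡ v
  to∘from (orig u)   = refl
  to∘from (edge i)   = refl
  to∘from (copy u a) = refl

  from∘to : ∀ v → from (to v) ≡ v
  from∘to (inj₁ (inj₁ u)) = refl
  from∘to (inj₁ (inj₂ ε)) = cong (inj₁ ∘ inj₂) (proj₂ (edge-spoke ε))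
  from∘to (inj₂ (u , a))  = refl

  from-mono : ∀ {v w} → v ~ w → Adj G (from v) (from w)
  from-mono (orig-edge inc) = incident⇒endpoint inc
  from-mono (edge-orig inc) = incident⇒endpoint inc
  from-mono (copy-edge inc) = incident⇒endpoint inc
  from-mono (edge-copy inc) = incident⇒endpoint inc
  from-mono (copy-copy {u} ab) =
    Equivalence.from T-∧ (fromWitness {a? = Graph._≟_ (Star n) u u} refl , ab)

  from-cancel : ∀ v w → Adj G (from v) (from w) → v ~ w
  from-cancel (orig u)   (edge i)   p = orig-edge (endpoint⇒incident u i p)
  from-cancel (edge i)   (orig u)   p = edge-orig (endpoint⇒incident u i p)
  from-cancel (edge i)   (copy u a) p = edge-copy (endpoint⇒incident u i p)
  from-cancel (copy u a) (edge i)   p = copy-edge (endpoint⇒incident u i p)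
  from-cancel (copy u a) (copy v b) p with Equivalence.to T-∧ p
  ... | u≟v , ab with refl ← toWitness {a? = Graph._≟_ (Star n) u v} u≟v = copy-copy ab

  to-mono : ∀ {v w} → Adj G v w → to v ~ to w
  to-mono {v} {w} p = from-cancel (to v) (to w)
    (subst₂ (Adj G) (sym (from∘to v)) (sym (from∘to w)) p)

  colouring : ∀ {k} {c : CoronaVertex n t → Fin k} → IsBColouring _~_ c →
              HasBChromaticColoring G k
  colouring b = _ , IsBColouring-∘ to from to∘from to-mono from-mono b

  model-colouring : ∀ {k} → HasBChromaticColoring G k →
                    ∃ λ (c : CoronaVertex n t → Fin k) → IsBColouring _~_ c
  model-colouring (_ , b) = _ , IsBColouring-∘ from to from∘to from-mono to-mono b

-- Upper bounds.

module UpperBounds {n t k} (2<n : 2 < n) (0<t : 0 < t)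
                   (c : CoronaVertex n t → Fin k) (b : IsBColouring _~_ c) where

  IsB : Fin k → CoronaVertex n t → Set
  IsB = IsBVertexIn _~_ c

  -- The colour of a b-vertex, put in front of those of its neighbours, completes a list of all `k`
  -- colours.
  degree-bound : ∀ {m j v} → IsB j v → (g : Fin m → Fin k) →
                 (∀ {w} → v ~ w → ∃ λ p → g p ≡ c w) → k ≤ suc m
  degree-bound {m} {j} (_ , sees) g cov = strictlySurjective⇒≤ {g = g′} surj
    where
    g′ : Fin (suc m) → Fin k
    g′ zero    = j
    g′ (suc p) = g p

    surj : StrictlySurjective _≡_ g′
    surj i with i ≟ j
    ... | yes refl = zero , refl
    ... | no i≢j with _ , vw , refl ← sees i i≢j = map suc id (cov vw)

  pendant-bound : ∀ {i j} → IsB j (orig (suc i)) → k ≤ 2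
  pendant-bound {i} bv = degree-bound bv (λ _ → c (edge i))
    λ { (orig-edge leaf) → zero {0} , refl }

  outer-leaf-bound : ∀ {i a j} → IsB j (copy (suc i) (suc a)) → k ≤ 3
  outer-leaf-bound {i} bv = degree-bound bv
    (λ { zero → c (edge i) ; (suc zero) → c (copy (suc i) zero) })
    λ { (copy-edge leaf) → zero , refl ; (copy-copy {b = zero} _) → suc zero , refl }

  outer-centre-bound : ∀ {i j} → IsB j (copy (suc i) zero) → k ≤ 2 + t
  outer-centre-bound {i} bv = degree-bound bv
    (λ { zero → c (edge i) ; (suc a) → c (copy (suc i) (suc a)) })
    λ { (copy-edge leaf) → zero , refl ; (copy-copy {b = suc a} _) → suc a , refl }

  -- Here `g` lists a set of colours containing all those of the edge vertices.
  module _ {m} (g : Fin m → Fin k) (cov : ∀ i → ∃ λ p → g p ≡ c (edge i)) where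

    hubs : Fin (suc m) → Fin k
    hubs zero    = c (copy zero zero)
    hubs (suc p) = g p

    centre-bound : ∀ {j} → IsB j (orig zero) → k ≤ suc m
    centre-bound bv = degree-bound bv g λ { (orig-edge hub) → cov _ }

    inner-leaf-bound : ∀ {a j} → IsB j (copy zero (suc a)) → k ≤ 2 + m
    inner-leaf-bound bv = degree-bound bv hubs
      λ { (copy-edge hub) → map suc id (cov _) ; (copy-copy {b = zero} _) → zero , refl }

  k≤1+2n : k ≤ n + suc n
  k≤1+2n = covering⇒≤ (g ∘ splitAt n) ≤-refl
    λ j → let v , bv = proj₂ b j in cover v bv
    where
    g : Fin n ⊎ Fin (suc n) → Fin k
    g = [ c ∘ edge , (λ u → c (copy u zero)) ]′

    -- The degree bounds for all remaining vertices are at most `2 + n`.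
    small : ∀ {m} → m ≤ 2 + n → m ≤ n + suc n
    small m≤2+n = ≤-trans m≤2+n (+-mono-≤ (<⇒≤ 2<n) (n≤1+n n))

    hit : ∀ {j} s → g s ≡ j → ∃ λ p → g (splitAt n p) ≡ j
    hit s eq = join n (suc n) s , trans (cong g (splitAt-join n (suc n) s)) eq

    cover : ∀ {j} v → IsB j v → (∃ λ p → g (splitAt n p) ≡ j) ⊎ k ≤ n + suc n
    cover (edge i)      (eq , _) = inj₁ (hit (inj₁ i) eq)
    cover (copy u zero) (eq , _) = inj₁ (hit (inj₂ u) eq)
    cover (orig zero)    bv =
      inj₂ (small (≤-trans (centre-bound (c ∘ edge) (λ i → i , refl) bv) (n≤1+n _)))
    cover (orig (suc _)) bv = inj₂ (small (≤-trans (pendant-bound bv) (m≤m+n 2 n)))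
    cover (copy zero (suc _)) bv =
      inj₂ (small (inner-leaf-bound (c ∘ edge) (λ i → i , refl) bv))
    cover (copy (suc _) (suc _)) bv =
      inj₂ (small (≤-trans (outer-leaf-bound bv) (≤-trans 2<n (m≤n+m n 2))))

  module _ (2+t<k : 2 + t < k) where

    data Big : CoronaVertex n t → Set where
      edge   : ∀ i → Big (edge i)
      centre : Big (orig zero)
      inner  : ∀ a → Big (copy zero a)

    isB⇒big : ∀ {j} v → IsB j v → Big v
    isB⇒big (edge i)       bv = edge i
    isB⇒big (orig zero)    bv = centre
    isB⇒big (copy zero a)  bv = inner a
    isB⇒big (orig (suc _)) bv =
      contradiction (≤-trans (pendant-bound bv) (m≤m+n 2 t)) (<⇒≱ 2+t<k)
    isB⇒big (copy (suc _) zero) bv = contradiction (outer-centre-bound bv) (<⇒≱ 2+t<k)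
    isB⇒big (copy (suc _) (suc _)) bv =
      contradiction (≤-trans (outer-leaf-bound bv) (+-monoʳ-≤ 2 0<t)) (<⇒≱ 2+t<k)

    -- If every b-vertex is an edge vertex or the centre of H₀, the `1 + m` entries of `hubs`
    -- exhaust the colours; otherwise x or a leaf of H₀ gives the bound by its degree.
    edge-colours-bound : ∀ {m} (g : Fin m → Fin k) → (∀ i → ∃ λ p → g p ≡ c (edge i)) →
                         k ≤ 2 + m
    edge-colours-bound {m} g cov = covering⇒≤ (hubs g cov) (n≤1+n _)
      λ j → let v , bv = proj₂ b j in cover (isB⇒big v bv) bv
      where
      cover : ∀ {j v} → Big v → IsB j v → (∃ λ p → hubs g cov p ≡ j) ⊎ k ≤ 2 + m
      cover (edge i) (refl , _)      = inj₁ (map suc id (cov i))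
      cover centre bv                = inj₂ (≤-trans (centre-bound g cov bv) (n≤1+n _))
      cover (inner zero) (eq , _)    = inj₁ (zero , eq)
      cover (inner (suc a)) bv       = inj₂ (inner-leaf-bound g cov bv)

    -- x and all of H₀ are adjacent to every edge vertex, so they never carry an edge colour.
    edge-colour-bvertex : ∀ i → ∃ λ i′ → IsB (c (edge i)) (edge i′)
    edge-colour-bvertex i with v , bv ← proj₂ b (c (edge i)) with isB⇒big v bv | bv
    ... | edge i′ | bv′     = i′ , bv′
    ... | centre  | eq , _ = contradiction eq (proj₁ b _ _ (orig-edge hub))
    ... | inner a | eq , _ = contradiction eq (proj₁ b _ _ (copy-edge hub))

    module _ {j i} (bv : IsB j (edge i)) where

      surroundings : Fin (3 + t) → Fin k
      surroundings zero          = j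
      surroundings (suc zero)    = c (orig (suc i))
      surroundings (suc (suc a)) = c (copy (suc i) a)

      -- An edge colour other than `j` must be seen from `edge i`, and not at x or in H₀, hence at
      -- the leaf of Sₙ or in the outer copy.
      surroundings-cover : ∀ i′ → ∃ λ p → surroundings p ≡ c (edge i′)
      surroundings-cover i′ with c (edge i′) ≟ j
      ... | yes eq = zero , sym eq
      ... | no c≢j with proj₂ bv _ c≢j
      ...   | _ , edge-orig leaf , eq = suc zero , eq
      ...   | _ , edge-copy leaf , eq = suc (suc _) , eq
      ...   | _ , edge-orig hub  , eq = contradiction eq (proj₁ b _ _ (orig-edge hub))
      ...   | _ , edge-copy hub  , eq = contradiction eq (proj₁ b _ _ (copy-edge hub))

    k≤2+n⊓[3+t] : k ≤ 2 + (n ⊓ (3 + t))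
    k≤2+n⊓[3+t] = ⊓-glb
      (edge-colours-bound (c ∘ edge) (λ i → i , refl))
      (edge-colours-bound (surroundings bv) (surroundings-cover bv))
      -- Any edge vertex would do; `2<n` supplies the index 2.
      where bv = proj₂ (edge-colour-bvertex (fromℕ< 2<n))

-- Lower bounds by explicit colourings.

-- The colours are 0 for the centre of H₀, then n for the eᵢ, then d more whose
-- b-vertices are centres of outer copies.
module RainbowEdges {n t d} (0<d : 0 < d) (d≤n : d ≤ n) (n+d≤1+t : n + d ≤ suc t) where

  open SurjectionAvoiding

  k : ℕ
  k = suc (n + d)

  0<n : 0 < n
  0<n = ≤-trans 0<d d≤n

  d≤t : d ≤ t
  d≤t = s≤s⁻¹ (≤-trans (+-mono-≤ 0<n (≤-refl {d})) n+d≤1+t)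

  -- Colours the centres of the outer copies, so that each extra colour gets a b-vertex.
  extraOf : ∃ λ (f : Fin n → Fin d) → StrictlySurjective _≡_ f
  extraOf = surjection 0<d d≤n

  -- Colours the leaves of H₀, so that its centre sees every extra colour.
  innerOf : ∃ λ (f : Fin t → Fin d) → StrictlySurjective _≡_ f
  innerOf = surjection 0<d d≤t

  ε : Fin n → Fin k
  ε i = suc (i ↑ˡ d)

  extra : Fin d → Fin k
  extra p = suc (n ↑ʳ p)

  ε≢extra : ∀ i p → ε i ≢ extra p
  ε≢extra i p eq with () ← trans (sym (splitAt-↑ˡ n i d))
                       (trans (cong (splitAt n) (suc-injective eq)) (splitAt-↑ʳ n d p))

  κ : Fin n → Fin k
  κ i = extra (proj₁ extraOf i)

  -- With these colours on the leaves of an outer copy, both its centre and the edge vertex see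
  -- everything: each supplies its own colour to the other. There is room because `k ≤ 2 + t`.
  rest : ∀ i → SurjectionAvoiding t (ε i) (κ i)
  rest i = surjection-avoiding (s≤s (+-mono-≤ 0<n 0<d)) (s≤s n+d≤1+t)
             (ε i) (κ i) (ε≢extra i _)

  c : CoronaVertex n t → Fin k
  c (orig _)               = zero
  c (edge i)               = ε i
  c (copy zero zero)       = zero
  c (copy zero (suc a))    = extra (proj₁ innerOf a)
  c (copy (suc i) zero)    = κ i
  c (copy (suc i) (suc a)) = at (rest i) a

  copy≢edge : ∀ {u i} a → Incident u i → c (copy u a) ≢ ε i
  copy≢edge zero    hub  ()
  copy≢edge (suc a) hub  = ≢-sym (ε≢extra _ _)
  copy≢edge zero    leaf = ≢-sym (ε≢extra _ _)
  copy≢edge (suc a) leaf = avoids₁ (rest _) a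

  leaf≢centre : ∀ u a → c (copy u (suc a)) ≢ c (copy u zero)
  leaf≢centre zero    a ()
  leaf≢centre (suc i) a = avoids₂ (rest i) a

  proper : ∀ v w → v ~ w → c v ≢ c w
  proper _ _ (orig-edge _)     ()
  proper _ _ (edge-orig _)     ()
  proper _ _ (copy-edge inc)   = copy≢edge _ inc
  proper _ _ (edge-copy inc)   = ≢-sym (copy≢edge _ inc)
  proper _ _ (copy-copy {u} {zero}  {suc a} _) = ≢-sym (leaf≢centre u a)
  proper _ _ (copy-copy {u} {suc a} {zero}  _) = leaf≢centre u a

  edge-bvertex : ∀ i → IsBVertexIn _~_ c (ε i) (edge i)
  edge-bvertex i = refl , sees
    where
    sees : ∀ j → j ≢ ε i → ∃ λ w → edge i ~ w × c w ≡ j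
    sees j j≢ε with j ≟ κ i
    ... | yes j≡κ = copy (suc i) zero , edge-copy leaf , sym j≡κ
    ... | no j≢κ  = let a , eq = hits (rest i) j j≢ε j≢κ in
                    copy (suc i) (suc a) , edge-copy leaf , eq

  outer-bvertex : ∀ i → IsBVertexIn _~_ c (κ i) (copy (suc i) zero)
  outer-bvertex i = refl , sees
    where
    sees : ∀ j → j ≢ κ i → ∃ λ w → copy (suc i) zero ~ w × c w ≡ j
    sees j j≢κ with j ≟ ε i
    ... | yes j≡ε = edge i , copy-edge leaf , sym j≡ε
    ... | no j≢ε  = let a , eq = hits (rest i) j j≢ε j≢κ in
                    copy (suc i) (suc a) , copy-copy tt , eq

  data Nonzero : Fin k → Set where
    isEdge  : ∀ i → Nonzero (ε i)
    isExtra : ∀ p → Nonzero (extra p)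

  nonzero : ∀ j → Nonzero (suc j)
  nonzero j with splitAt n j | join-splitAt n d j
  ... | inj₁ i | refl = isEdge i
  ... | inj₂ p | refl = isExtra p

  inner-bvertex : IsBVertexIn _~_ c zero (copy zero zero)
  inner-bvertex = refl , λ where
      zero    0≢0 → contradiction refl 0≢0
      (suc j) _   → sees (nonzero j)
    where
    sees : ∀ {j} → Nonzero j → ∃ λ w → copy zero zero ~ w × c w ≡ j
    sees (isEdge i)  = edge i , copy-edge hub , refl
    sees (isExtra p) = let a , eq = proj₂ innerOf p in
                       copy zero (suc a) , copy-copy tt , cong extra eq

  isBColouring : IsBColouring _~_ c
  isBColouring = proper , λ where
      zero    → _ , inner-bvertex
      (suc j) → bvertex (nonzero j)
    where
    bvertex : ∀ {j} → Nonzero j → ∃ λ v → IsBVertexIn _~_ c j v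
    bvertex (isEdge i)  = _ , edge-bvertex i
    bvertex (isExtra p) with i , refl ← proj₂ extraOf p = _ , outer-bvertex i

-- Colours 0 and 1 are reserved for H₀, and the a others are those of the eᵢ.
module SaturatedEdges {n t a} (2<a : 2 < a) (a≤n : a ≤ n) (a≤3+t : a ≤ 3 + t)
                      (0<t : 0 < t) where

  open SurjectionAvoiding

  edgeColour : ∃ λ (f : Fin n → Fin a) → StrictlySurjective _≡_ f
  edgeColour = surjection (≤-trans (s≤s z≤n) 2<a) a≤n

  ε : Fin n → Fin a
  ε = proj₁ edgeColour

  other : ∀ {a} → 2 < a → (r : Fin a) → ∃ λ s → r ≢ s
  other (s≤s (s≤s _)) r = punchIn r zero , ≢-sym (punchInᵢ≢i r zero)

  κ : Fin n → Fin a
  κ i = proj₁ (other 2<a (ε i))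

  -- The `1 + t` positions are the leaf of Sₙ, at `zero`, and the `t` leaves of the outer copy; this
  -- is where `a ≤ 3 + t` enters.
  rest : ∀ i → SurjectionAvoiding (suc t) (ε i) (κ i)
  rest i = surjection-avoiding 2<a a≤3+t (ε i) (κ i) (proj₂ (other 2<a (ε i)))

  shift : Fin a → Fin (2 + a)
  shift r = suc (suc r)

  -- The leaf of Sₙ at eᵢ plays the role of one more leaf of Hᵢ.
  c : CoronaVertex n t → Fin (2 + a)
  c (orig zero)            = zero
  c (orig (suc i))         = shift (at (rest i) zero)
  c (edge i)               = shift (ε i)
  c (copy zero zero)       = zero
  c (copy zero (suc _))    = suc zero
  c (copy (suc i) zero)    = shift (κ i)
  c (copy (suc i) (suc l)) = shift (at (rest i) (suc l))

  shift-injective : ∀ {i j} → shift i ≡ shift j → i ≡ j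
  shift-injective = suc-injective ∘ suc-injective

  orig≢edge : ∀ {u i} → Incident u i → c (orig u) ≢ c (edge i)
  orig≢edge hub  ()
  orig≢edge leaf = avoids₁ (rest _) zero ∘ shift-injective

  copy≢edge : ∀ {u i} l → Incident u i → c (copy u l) ≢ c (edge i)
  copy≢edge zero    hub  ()
  copy≢edge (suc l) hub  ()
  copy≢edge zero    leaf = ≢-sym (proj₂ (other 2<a _)) ∘ shift-injective
  copy≢edge (suc l) leaf = avoids₁ (rest _) (suc l) ∘ shift-injective

  leaf≢centre : ∀ u l → c (copy u (suc l)) ≢ c (copy u zero)
  leaf≢centre zero    l ()
  leaf≢centre (suc i) l = avoids₂ (rest i) (suc l) ∘ shift-injective

  proper : ∀ v w → v ~ w → c v ≢ c w
  proper _ _ (orig-edge inc)   = orig≢edge inc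
  proper _ _ (edge-orig inc)   = ≢-sym (orig≢edge inc)
  proper _ _ (copy-edge inc)   = copy≢edge _ inc
  proper _ _ (edge-copy inc)   = ≢-sym (copy≢edge _ inc)
  proper _ _ (copy-copy {u} {zero}  {suc l} _) = ≢-sym (leaf≢centre u l)
  proper _ _ (copy-copy {u} {suc l} {zero}  _) = leaf≢centre u l

  inner-leaf : CoronaVertex n t
  inner-leaf = copy zero (suc (fromℕ< 0<t))

  -- Every vertex of H₀ is adjacent to all edge vertices, whose colours exhaust `Fin a`.
  sees-edges : ∀ {l} r → ∃ λ w → copy zero l ~ w × c w ≡ shift r
  sees-edges r = let i , eq = proj₂ edgeColour r in
                 edge i , copy-edge hub , cong shift eq

  centre-bvertex : IsBVertexIn _~_ c zero (copy zero zero)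
  centre-bvertex = refl , λ where
      zero          0≢0 → contradiction refl 0≢0
      (suc zero)    _   → inner-leaf , copy-copy tt , refl
      (suc (suc r)) _   → sees-edges r

  leaf-bvertex : IsBVertexIn _~_ c (suc zero) inner-leaf
  leaf-bvertex = refl , λ where
      zero          _   → copy zero zero , copy-copy tt , refl
      (suc zero)    1≢1 → contradiction refl 1≢1
      (suc (suc r)) _   → sees-edges r

  edge-bvertex : ∀ i → IsBVertexIn _~_ c (shift (ε i)) (edge i)
  edge-bvertex i = refl , λ where
      zero          _   → copy zero zero , edge-copy hub , refl
      (suc zero)    _   → inner-leaf , edge-copy hub , refl
      (suc (suc r)) r≢ε → sees r (r≢ε ∘ cong shift)
    where
    sees : ∀ r → r ≢ ε i → ∃ λ w → edge i ~ w × c w ≡ shift r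
    sees r r≢ε with r ≟ κ i
    ... | yes r≡κ = copy (suc i) zero , edge-copy leaf , cong shift (sym r≡κ)
    ... | no r≢κ with hits (rest i) r r≢ε r≢κ
    ...   | zero  , eq = orig (suc i) , edge-orig leaf , cong shift eq
    ...   | suc l , eq = copy (suc i) (suc l) , edge-copy leaf , cong shift eq

  isBColouring : IsBColouring _~_ c
  isBColouring = proper , λ where
      zero          → _ , centre-bvertex
      (suc zero)    → _ , leaf-bvertex
      (suc (suc r)) → bvertex (proj₂ edgeColour r)
    where
    bvertex : ∀ {r} → (∃ λ i → ε i ≡ r) → ∃ λ v → IsBVertexIn _~_ c (shift r) v
    bvertex (i , refl) = _ , edge-bvertex i

-- The three ranges of n relative to t.

theorem18 : ∀ (n t : ℕ) → n > 2 → t > 2 →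
    IsBChromaticNumber (Star n ⊡ Star t)
    (if ⌊ 2 * n ≤? t + 1 ⌋ then 2 * n + 1
    else if ⌊ t + 1 <? 2 * n ⌋ ∧ ⌊ n <? t ⌋ then t + 2
    else (n ⊓ (t + 3)) + 2)
theorem18 n t 2<n 2<t with 2 * n ≤? t + 1
... | yes 2n≤t+1 = subst Has (sym 2n+1≡) lower , upper
  where
  open Transfer n t
  Has = HasBChromaticColoring G

  n+n≤1+t : n + n ≤ suc t
  n+n≤1+t = subst (_≤ suc t) (cong (n +_) (+-identityʳ n))
              (≤-trans 2n≤t+1 (≤-reflexive (+-comm t 1)))

  2n+1≡ : 2 * n + 1 ≡ suc (n + n)
  2n+1≡ = trans (+-comm (2 * n) 1) (cong (λ m → suc (n + m)) (+-identityʳ n))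

  lower : Has (suc (n + n))
  -- Here `d = n`, one extra colour for each outer copy.
  lower = colouring (RainbowEdges.isBColouring (m<n⇒0<n 2<n) ≤-refl n+n≤1+t)

  upper : ∀ l → Has l → l ≤ 2 * n + 1
  upper l has = let c , b = model-colouring has in
    subst (l ≤_) (trans (+-suc n n) (sym 2n+1≡)) (UpperBounds.k≤1+2n 2<n (m<n⇒0<n 2<t) c b)
... | no 2n≰t+1 with t + 1 <? 2 * n
-- The failed first test already gives `t + 1 < 2 * n`, so this branch is void.
...   | no t+1≮2n = contradiction (≰⇒> 2n≰t+1) t+1≮2n
...   | yes t+1<2n with n <? t
...     | yes n<t = subst Has k≡ lower , upper
  where
  open Transfer n t
  Has = HasBChromaticColoring G

  n≤1+t : n ≤ suc t
  n≤1+t = ≤-trans (<⇒≤ n<t) (n≤1+n t)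

  d≤n : suc t ∸ n ≤ n
  d≤n = m≤n+o⇒m∸n≤o (suc t) n (subst (_≤ n + n) (+-comm t 1)
    (<⇒≤ (subst (t + 1 <_) (cong (n +_) (+-identityʳ n)) t+1<2n)))

  k≡ : suc (n + (suc t ∸ n)) ≡ t + 2
  k≡ = trans (cong suc (m+[n∸m]≡n n≤1+t)) (+-comm 2 t)

  lower : Has (suc (n + (suc t ∸ n)))
  -- Taking `d = suc t ∸ n` makes the number of colours exactly `t + 2`; `d ≤ n` comes from the
  -- failed first test.
  lower = colouring (RainbowEdges.isBColouring
    (m<n⇒0<n∸m (≤-trans n<t (n≤1+n t))) d≤n (≤-reflexive (m+[n∸m]≡n n≤1+t)))

  upper : ∀ l → Has l → l ≤ t + 2
  -- With more than `2 + t` colours the other bound would apply and give `l ≤ 2 + n ≤ 2 + t`.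
  upper l has = subst (l ≤_) (+-comm 2 t) (decidable-stable (l ≤? 2 + t) λ l≰2+t →
    let c , b = model-colouring has in
    l≰2+t (≤-trans (UpperBounds.k≤2+n⊓[3+t] 2<n (m<n⇒0<n 2<t) c b (≰⇒> l≰2+t))
                   (+-monoʳ-≤ 2 (≤-trans (m⊓n≤m n (3 + t)) (<⇒≤ n<t)))))
...     | no n≮t = subst Has k≡ lower , upper
  where
  open Transfer n t
  Has = HasBChromaticColoring G

  t≤a : t ≤ n ⊓ (3 + t)
  t≤a = ⊓-glb (≮⇒≥ n≮t) (m≤n+m t 3)

  k≡ : 2 + (n ⊓ (3 + t)) ≡ n ⊓ (t + 3) + 2
  k≡ = trans (+-comm 2 (n ⊓ (3 + t))) (cong (λ m → n ⊓ m + 2) (+-comm 3 t))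

  lower : Has (2 + (n ⊓ (3 + t)))
  lower = colouring (SaturatedEdges.isBColouring
    (≤-trans 2<t t≤a) (m⊓n≤m n (3 + t)) (m⊓n≤n n (3 + t)) (m<n⇒0<n 2<t))

  upper : ∀ l → Has l → l ≤ n ⊓ (t + 3) + 2
  -- Since `t ≤ n ⊓ (3 + t)`, exceeding the claimed value means more than `2 + t` colours, where the
  -- bound applies.
  upper l has = subst (l ≤_) k≡ (decidable-stable (l ≤? 2 + (n ⊓ (3 + t))) λ l≰ →
    let c , b = model-colouring has in
    l≰ (UpperBounds.k≤2+n⊓[3+t] 2<n (m<n⇒0<n 2<t) c b
         (≤-trans (s≤s (+-monoʳ-≤ 2 t≤a)) (≰⇒> l≰))))
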